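{- Let $n$ and $k$ be integers such that $n \geq 2$ and $1 < k < n$. Then $\mathcal{D}_k(K_n)$ is Eulerian if and only if $n$ is odd and $k=2$.
   Context: All graphs are finite and simple. $K_n$ is the complete graph on $n$ vertices. A dominating set of a graph $G$ is a set $D \subseteq V(G)$ such that every vertex of $V(G)\setminus D$ is adjacent to a vertex of $D$. The $k$-dominating graph $\mathcal{D}_k(G)$ is the graph whose vertices are the dominating sets of $G$ of cardinality at most $k$, two of them being adjacent if and only if one can be obtained from the other by adding or removing a single vertex of $G$. A graph is Eulerian if and only if every vertex has even degree and it contains at most one non-trivial component (a graph or component is trivial if it contains no edges). -}

module Defs where

open import Data.Bool.Base using (Bool)
import Data.Bool.Properties as Bool
open import Data.Empty.Irrelevant using (⊥-elim)
open import Data.Fin.Base using (Fin; zero; suc)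
import Data.Fin.Properties as Fin
open import Data.Fin.Subset using (Subset; _∈_; _∉_; _∪_; _-_; ⁅_⁆; ∣_∣)
open import Data.Fin.Subset.Properties
  using (_∈?_; x∈⁅x⁆; q⊆p∪q; x∈p⇒p-x⊂p; ⊂-irref)
open import Data.Irrelevant using ([_])
open import Data.Nat.Base using (ℕ; zero; suc; _≤_; _^_)
open import Data.Nat.Divisibility using (_∣_)
import Data.Nat.Properties as ℕ
open import Data.Product.Base using (_×_; _,_; ∃; ∃-syntax; proj₁; proj₂)
open import Data.Product.Function.NonDependent.Propositional using (_×-↔_)
open import Data.Refinement using (Refinement; Refinement-syntax; value; proof; value-injective)
  renaming (_,_ to infixr 4 _⊣_)
open import Data.Sum.Base using (_⊎_; inj₁; inj₂; swap)
open import Data.Vec.Base using (Vec; []; _∷_)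
open import Data.Vec.Properties using (≡-dec)
open import Function.Base using (_∘_)
open import Function.Bundles using (_↔_; Inverse; mk↔ₛ′)
open import Function.Construct.Composition using (_↔-∘_)
open import Function.Construct.Identity using (↔-id)
open import Function.Construct.Symmetry using (↔-sym)
open import Relation.Binary.Construct.Closure.ReflexiveTransitive using (Star)
open import Relation.Binary.PropositionalEquality
  using (_≡_; _≢_; refl; sym; cong; subst; ≢-sym)
open import Relation.Nullary using (¬_; Dec; yes; no)
open import Relation.Nullary.Decidable using (map′; _×-dec_; _⊎-dec_; _→-dec_; ¬?)
import Relation.Unary as U

Finite : Set → Set
Finite A = ∃[ n ] (A ↔ Fin n)

card : {A : Set} → Finite A → ℕ
card = proj₁

Fin-refinement-finite : ∀ n {P : Fin n → Set} → U.Decidable P →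
                        Finite (Refinement (Fin n) P)
Fin-refinement-finite zero P? =
  0 , mk↔ₛ′ value (λ ()) (λ ()) (λ { (() ⊣ _) })
Fin-refinement-finite (suc n) {P} P?
  with P? zero | Fin-refinement-finite n (P? ∘ suc)
... | no ¬p | m , φ = m , mk↔ₛ′ to from to-from from-to
  where
  module φ = Inverse φ
  to : Refinement (Fin (suc n)) P → Fin m
  to (zero  ⊣ [ p ]) = ⊥-elim (¬p p)
  to (suc i ⊣ p) = φ.to (i ⊣ p)
  from : Fin m → Refinement (Fin (suc n)) P
  from j = suc (value (φ.from j)) ⊣ proof (φ.from j)
  to-from : ∀ j → to (from j) ≡ j
  to-from j = φ.strictlyInverseˡ j
  from-to : ∀ x → from (to x) ≡ x
  from-to (zero  ⊣ [ p ]) = ⊥-elim (¬p p)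
  from-to (suc i ⊣ p) =
    value-injective (cong (suc ∘ value) (φ.strictlyInverseʳ (i ⊣ p)))
... | yes p₀ | m , φ = suc m , mk↔ₛ′ to from to-from from-to
  where
  module φ = Inverse φ
  to : Refinement (Fin (suc n)) P → Fin (suc m)
  to (zero  ⊣ _) = zero
  to (suc i ⊣ p) = suc (φ.to (i ⊣ p))
  from : Fin (suc m) → Refinement (Fin (suc n)) P
  from zero    = zero ⊣ [ p₀ ]
  from (suc j) = suc (value (φ.from j)) ⊣ proof (φ.from j)
  to-from : ∀ j → to (from j) ≡ j
  to-from zero    = refl
  to-from (suc j) = cong suc (φ.strictlyInverseˡ j)
  from-to : ∀ x → from (to x) ≡ x
  from-to (zero  ⊣ _) = refl
  from-to (suc i ⊣ p) =
    value-injective (cong (suc ∘ value) (φ.strictlyInverseʳ (i ⊣ p)))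

module _ {A : Set} (A-finite : Finite A) {P : A → Set} (P? : U.Decidable P) where

  private
    module ι = Inverse (proj₂ A-finite)

    via : (∀ i → P (ι.from i)) → ∀ x → P x
    via f x = subst P (ι.strictlyInverseʳ x) (f (ι.to x))

  finite-all? : Dec (∀ x → P x)
  finite-all? = map′ via (_∘ ι.from) (Fin.all? (P? ∘ ι.from))

  finite-any? : Dec (∃ P)
  finite-any? = map′
    (λ (i , p) → ι.from i , p)
    (λ (x , p) → ι.to x , subst P (sym (ι.strictlyInverseʳ x)) p)
    (Fin.any? (P? ∘ ι.from))

  refinement-finite : Finite (Refinement A P)
  refinement-finite with Fin-refinement-finite (card A-finite) (P? ∘ ι.from)
  ... | m , φ = m , (φ ↔-∘ mk↔ₛ′ to from
      (λ y → value-injective (ι.strictlyInverseˡ (value y)))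
      (λ y → value-injective (ι.strictlyInverseʳ (value y))))
    where
    to : Refinement A P → Refinement (Fin (card A-finite)) (P ∘ ι.from)
    to (x ⊣ [ p ]) =
      ι.to x ⊣ [ subst P (sym (ι.strictlyInverseʳ x)) p ]
    from : Refinement (Fin (card A-finite)) (P ∘ ι.from) → Refinement A P
    from (i ⊣ p) = ι.from i ⊣ p

Subset-↔ : ∀ n → Subset n ↔ Fin (2 ^ n)
Subset-↔ zero    = mk↔ₛ′ (λ _ → zero) (λ _ → []) (λ { zero → refl }) (λ { [] → refl })
Subset-↔ (suc n) =
  ↔-sym Fin.*↔× ↔-∘ ((↔-sym Fin.2↔Bool ×-↔ Subset-↔ n) ↔-∘ uncons↔)
  where
  uncons↔ : Vec Bool (suc n) ↔ (Bool × Vec Bool n)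
  uncons↔ = mk↔ₛ′ (λ { (b ∷ bs) → b , bs }) (λ (b , bs) → b ∷ bs)
                  (λ _ → refl) (λ { (_ ∷ _) → refl })

record Graph : Set₁ where
  field
    V          : Set
    V-finite   : Finite V
    Adj        : V → V → Set
    adj?       : ∀ u v → Dec (Adj u v)
    adj-sym    : ∀ {u v} → Adj u v → Adj v u
    adj-irrefl : ∀ {v} → ¬ Adj v v

  order : ℕ
  order = card V-finite

  index : V → Fin order
  index = Inverse.to (proj₂ V-finite)

  -- A set D of vertices is represented by the `Subset order` of the
  -- indices of its elements.
  VertexSet : Set
  VertexSet = Subset order

  infix 4 _∈ᵥ_ _∉ᵥ_

  _∈ᵥ_ _∉ᵥ_ : V → VertexSet → Set
  v ∈ᵥ D = index v ∈ D
  v ∉ᵥ D = ¬ (v ∈ᵥ D)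

  -- `Refinement` makes the proof component irrelevant, so that every
  -- neighbour is counted exactly once.
  Neighbour : V → Set
  Neighbour v = [ w ∈ V ∣ Adj v w ]

  degree : V → ℕ
  degree v = card (refinement-finite V-finite (adj? v))

  Connected : V → V → Set
  Connected = Star Adj

  -- Components are given by representatives: the component of v is
  -- { w | Connected v w }. It is non-trivial when it contains an edge.
  NonTrivialComponent : V → Set
  NonTrivialComponent v = ∃[ a ] ∃[ b ] Connected v a × Connected v b × Adj a b

  AtMostOneNonTrivialComponent : Set
  AtMostOneNonTrivialComponent =
    ∀ u v → NonTrivialComponent u → NonTrivialComponent v → Connected u v

  Eulerian : Set
  Eulerian = (∀ v → 2 ∣ degree v) × AtMostOneNonTrivialComponent

  Dominating : VertexSet → Set
  Dominating D = ∀ v → v ∉ᵥ D → ∃[ u ] u ∈ᵥ D × Adj v u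

  dominating? : U.Decidable Dominating
  dominating? D = finite-all? V-finite λ v →
    ¬? (index v ∈? D) →-dec
    finite-any? V-finite λ u → (index u ∈? D) ×-dec adj? v u

  ObtainedFrom : VertexSet → VertexSet → Set
  ObtainedFrom D E =
    ∃[ x ] ((x ∉ᵥ D × E ≡ D ∪ ⁅ index x ⁆) ⊎ (x ∈ᵥ D × E ≡ D - index x))

  obtainedFrom? : ∀ D E → Dec (ObtainedFrom D E)
  obtainedFrom? D E = finite-any? V-finite λ x →
    (¬? (index x ∈? D) ×-dec ≡-dec Bool._≟_ E (D ∪ ⁅ index x ⁆)) ⊎-dec
    ((index x ∈? D) ×-dec ≡-dec Bool._≟_ E (D - index x))

  obtainedFrom-irrefl : ∀ {D} → ¬ ObtainedFrom D D
  obtainedFrom-irrefl {D} (x , inj₁ (x∉D , D≡)) =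
    x∉D (subst (index x ∈_) (sym D≡) (q⊆p∪q D ⁅ index x ⁆ (x∈⁅x⁆ (index x))))
  obtainedFrom-irrefl (x , inj₂ (x∈D , D≡)) = ⊂-irref (sym D≡) (x∈p⇒p-x⊂p x∈D)

open Graph using (Eulerian) public

K : ℕ → Graph
K n = record
  { V          = Fin n
  ; V-finite   = n , ↔-id (Fin n)
  ; Adj        = _≢_
  ; adj?       = λ u v → ¬? (u Fin.≟ v)
  ; adj-sym    = ≢-sym
  ; adj-irrefl = λ v≢v → v≢v refl
  }

𝒟 : ℕ → Graph → Graph
𝒟 k G = record
  { V          = [ D ∈ G.VertexSet ∣ G.Dominating D × ∣ D ∣ ≤ k ]
  ; V-finite   = refinement-finite (_ , Subset-↔ G.order)
                   (λ D → G.dominating? D ×-dec (∣ D ∣ ℕ.≤? k))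
  ; Adj        = λ D E → G.ObtainedFrom (value D) (value E) ⊎
                         G.ObtainedFrom (value E) (value D)
  ; adj?       = λ D E → G.obtainedFrom? (value D) (value E) ⊎-dec
                         G.obtainedFrom? (value E) (value D)
  ; adj-sym    = swap
  ; adj-irrefl = λ { (inj₁ p) → G.obtainedFrom-irrefl p
                   ; (inj₂ p) → G.obtainedFrom-irrefl p }
  }
  where module G = Graph G

{-# OPTIONS --safe #-}

-- For n ≥ 2 the vertices of 𝒟 k (K n) are the nonempty subsets of size at
-- most k, and the neighbours of D arise by toggling the membership of one
-- element. Hence D has degree n ∸ 1 if ∣ D ∣ ≡ 1, degree n if 1 < ∣ D ∣ < k
-- and degree k if ∣ D ∣ ≡ k ≥ 2. Singletons force n to be odd, and then sets of
-- size 2 force k ≡ 2. The graph is connected because every D shrinks to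
-- any singleton it contains.
module Submission where

open import Defs
open import Data.Bool.Base using (not)
open import Data.Bool.Properties using (not-involutive)
open import Data.Fin.Base using (Fin; zero; suc; toℕ; fromℕ<)
open import Data.Fin.Permutation using (↔⇒≡)
import Data.Fin.Properties as Fin
open import Data.Fin.Subset
  using (Subset; inside; outside; Nonempty; ∁; ⊤; _∈_; _∉_; _⊆_; _∪_; _-_; ⁅_⁆; ∣_∣)
open import Data.Fin.Subset.Properties
  using (_∈?_; nonempty?; Empty-unique; ∣⊥∣≡0; ∣⊤∣≡n; ∣⁅x⁆∣≡1; ∣∁p∣≡n∸∣p∣; ∈⊤; x∈⁅x⁆;
         x∈⁅y⁆⇒x≡y; x≢y⇒x∉⁅y⁆; x∈∁p⇒x∉p; x∉p⇒x∈∁p; ⊆-antisym; ∪-identityʳ;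
         drop-there; p─⊥≡p)
open import Data.Irrelevant using ([_])
open import Data.Nat.Base using (ℕ; zero; suc; _≥_; _<_; _≤_; _∸_; s<s; s<s⁻¹; z<s)
open import Data.Nat.Divisibility using (_∣_; ∣-refl; ∣m+n∣m⇒∣n; ∣m∣n⇒∣m+n; ∣1⇒≡1; _∣0)
import Data.Nat.Properties as ℕ
open import Data.Product.Base using (_×_; _,_; proj₁; proj₂; ∃)
open import Data.Refinement using (Refinement; value; value-injective)
  renaming (_,_ to infixr 4 _⊣_)
open import Data.Sum.Base using (_⊎_; inj₁; inj₂; [_,_]′)
open import Data.Vec.Base using ([]; _∷_; here; there; _[_]%=_)
open import Data.Vec.Properties
  using (updateAt-updateAt; updateAt-id-local; updateAt-minimal)
open import Function.Base using (_∘_; id; case_of_)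
open import Function.Bundles using (_⇔_; _↔_; Equivalence; mk⇔; mk↔ₛ′)
open import Function.Construct.Composition using (_↔-∘_)
open import Function.Construct.Symmetry using (↔-sym)
open import Relation.Binary.Construct.Closure.ReflexiveTransitive
  using (ε; _◅_; _◅◅_; reverse)
open import Relation.Binary.PropositionalEquality
  using (_≡_; _≢_; refl; sym; trans; cong; subst)
open import Relation.Nullary using (¬_; yes; no; contradiction)
open import Relation.Nullary.Decidable using (recompute; _×-dec_; ¬?)
import Relation.Unary as U

private
  variable
    n : ℕ

-- Counting finite types.

finite-card-unique : {A B : Set} (f : Finite A) (g : Finite B) → A ↔ B → card f ≡ card g
finite-card-unique (_ , φ) (_ , ψ) χ = ↔⇒≡ ((ψ ↔-∘ χ) ↔-∘ ↔-sym φ)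

-- Induction along the recursion of `Fin-refinement-finite`: a `yes` answer adds one to the count
-- exactly where `S` has `inside`.
card-Fin-refinement : {P : Fin n → Set} (P? : U.Decidable P) (S : Subset n) →
                      (∀ x → P x ⇔ x ∈ S) →
                      card (Fin-refinement-finite n P?) ≡ ∣ S ∣
card-Fin-refinement {zero} P? [] P⇔S = refl
card-Fin-refinement {suc n} P? (s ∷ S) P⇔S
  -- The first two terms repeat the scrutinees of `Fin-refinement-finite`, so that the goal
  -- computes; abstracting the induction hypothesis with them keeps its type about the same
  -- enumeration.
  with P? zero | Fin-refinement-finite n (P? ∘ suc) | card-Fin-refinement (P? ∘ suc) S
    (λ x → mk⇔ (drop-there ∘ Equivalence.to (P⇔S (suc x)))
               (Equivalence.from (P⇔S (suc x)) ∘ there))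
card-Fin-refinement P? (inside  ∷ S) P⇔S | no ¬p | _ | _ =
  contradiction (Equivalence.from (P⇔S zero) here) ¬p
card-Fin-refinement P? (outside ∷ S) P⇔S | no ¬p | _ | ih = ih
card-Fin-refinement P? (inside  ∷ S) P⇔S | yes p | _ | ih = cong suc ih
card-Fin-refinement P? (outside ∷ S) P⇔S | yes p | _ | _ =
  case Equivalence.to (P⇔S zero) p of λ ()

-- Subsets and toggling.

0<∣p∣⇒Nonempty : {p : Subset n} → 0 < ∣ p ∣ → Nonempty p
0<∣p∣⇒Nonempty {n} {p} 0<∣p∣ with nonempty? p
... | yes p≢∅ = p≢∅
... | no p≡∅ with refl ← Empty-unique p≡∅ = contradiction (∣⊥∣≡0 n) (ℕ.>⇒≢ 0<∣p∣)

-- A single involution covers insertion and removal, so that the neighbours of a set are indexed by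
-- elements of `Fin n`.
toggle : Fin n → Subset n → Subset n
toggle x p = p [ x ]%= not

toggle-involutive : ∀ (x : Fin n) p → toggle x (toggle x p) ≡ p
toggle-involutive x p =
  trans (updateAt-updateAt x p) (updateAt-id-local x p (not-involutive _))

x∉p⇒x∈toggle : ∀ {x : Fin n} {p} → x ∉ p → x ∈ toggle x p
x∉p⇒x∈toggle {x = zero}  {inside  ∷ p} x∉p = contradiction here x∉p
x∉p⇒x∈toggle {x = zero}  {outside ∷ p} x∉p = here
x∉p⇒x∈toggle {x = suc x} {_ ∷ p}       x∉p = there (x∉p⇒x∈toggle (x∉p ∘ there))

x∈p⇒x∉toggle : ∀ {x : Fin n} {p} → x ∈ p → x ∉ toggle x p
x∈p⇒x∉toggle (there x∈p) (there x∈t) = x∈p⇒x∉toggle x∈p x∈t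

-- Toggling at `x` changes the membership of `x`, whereas toggling at another element preserves it.
toggle-injectiveˡ : ∀ {x y : Fin n} p → toggle x p ≡ toggle y p → x ≡ y
toggle-injectiveˡ {x = x} {y} p eq with x Fin.≟ y | x ∈? p
... | yes x≡y | _       = x≡y
... | no  x≢y | yes x∈p = contradiction
  (subst (x ∈_) (sym eq) (updateAt-minimal x y p x≢y x∈p)) (x∈p⇒x∉toggle x∈p)
-- Here `x` lies in `toggle x p`, hence also in `toggle y (toggle x p)`, which equals
-- `toggle y (toggle y p)` and thus `p`.
... | no  x≢y | no  x∉p = contradiction
  (subst (x ∈_) (trans (cong (toggle y) eq) (toggle-involutive y p))
    (updateAt-minimal x y (toggle x p) x≢y (x∉p⇒x∈toggle x∉p)))
  x∉p

x∉p⇒∣toggle∣ : ∀ {x : Fin n} {p} → x ∉ p → ∣ toggle x p ∣ ≡ suc ∣ p ∣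
x∉p⇒∣toggle∣ {x = zero}  {inside  ∷ p} x∉p = contradiction here x∉p
x∉p⇒∣toggle∣ {x = zero}  {outside ∷ p} x∉p = refl
x∉p⇒∣toggle∣ {x = suc x} {inside  ∷ p} x∉p = cong suc (x∉p⇒∣toggle∣ (x∉p ∘ there))
x∉p⇒∣toggle∣ {x = suc x} {outside ∷ p} x∉p = x∉p⇒∣toggle∣ (x∉p ∘ there)

x∈p⇒∣toggle∣ : ∀ {x : Fin n} {p} → x ∈ p → suc ∣ toggle x p ∣ ≡ ∣ p ∣
x∈p⇒∣toggle∣ {x = x} {p} x∈p =
  trans (sym (x∉p⇒∣toggle∣ (x∈p⇒x∉toggle x∈p))) (cong ∣_∣ (toggle-involutive x p))

x∈p⇒0<∣p∣ : ∀ {x : Fin n} {p} → x ∈ p → 0 < ∣ p ∣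
x∈p⇒0<∣p∣ x∈p = subst (0 <_) (x∈p⇒∣toggle∣ x∈p) z<s

∪-⁅⁆≡toggle : ∀ {x : Fin n} {p} → x ∉ p → p ∪ ⁅ x ⁆ ≡ toggle x p
∪-⁅⁆≡toggle {x = zero}  {inside  ∷ p} x∉p = contradiction here x∉p
∪-⁅⁆≡toggle {x = zero}  {outside ∷ p} x∉p = cong (inside ∷_) (∪-identityʳ p)
∪-⁅⁆≡toggle {x = suc x} {inside  ∷ p} x∉p = cong (inside ∷_) (∪-⁅⁆≡toggle (x∉p ∘ there))
∪-⁅⁆≡toggle {x = suc x} {outside ∷ p} x∉p = cong (outside ∷_) (∪-⁅⁆≡toggle (x∉p ∘ there))

-≡toggle : ∀ {x : Fin n} {p} → x ∈ p → p - x ≡ toggle x p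
-≡toggle {p = _ ∷ p} here        = cong (outside ∷_) (p─⊥≡p p)
-≡toggle {p = b ∷ _} (there x∈p) = cong (b ∷_) (-≡toggle x∈p)

-- Edges and vertices of `𝒟 k (K n)` in terms of `toggle`.

obtainedFrom⇒toggle : ∀ {p q} → Graph.ObtainedFrom (K n) p q → ∃ λ x → q ≡ toggle x p
obtainedFrom⇒toggle (x , inj₁ (x∉p , refl)) = x , ∪-⁅⁆≡toggle x∉p
obtainedFrom⇒toggle (x , inj₂ (x∈p , refl)) = x , -≡toggle x∈p

toggle-obtainedFrom : ∀ (x : Fin n) p → Graph.ObtainedFrom (K n) p (toggle x p)
toggle-obtainedFrom x p with x ∈? p
... | yes x∈p = x , inj₂ (x∈p , sym (-≡toggle x∈p))
... | no  x∉p = x , inj₁ (x∉p , sym (∪-⁅⁆≡toggle x∉p))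

-- In a complete graph any one member is adjacent to every vertex outside the set. Conversely `zero`
-- is a member or has a neighbour that is; the order is `suc n` because the empty set dominates
-- `K 0`.
dominating⇔0<∣p∣ : {p : Subset (suc n)} → Graph.Dominating (K (suc n)) p ⇔ 0 < ∣ p ∣
dominating⇔0<∣p∣ {n} {p} = mk⇔ to from
  where
  to : Graph.Dominating (K (suc n)) p → 0 < ∣ p ∣
  to dom with zero ∈? p
  ... | yes 0∈p = x∈p⇒0<∣p∣ 0∈p
  ... | no  0∉p with _ , u∈p , _ ← dom zero 0∉p = x∈p⇒0<∣p∣ u∈p
  from : 0 < ∣ p ∣ → Graph.Dominating (K (suc n)) p
  from 0<∣p∣ v v∉p with u , u∈p ← 0<∣p∣⇒Nonempty 0<∣p∣ =
    u , u∈p , λ { refl → v∉p u∈p }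

IsVertex : ℕ → Subset n → Set
IsVertex {n} k p = Graph.Dominating (K n) p × ∣ p ∣ ≤ k

isVertex? : ∀ k → U.Decidable (IsVertex {n} k)
isVertex? {n} k p = Graph.dominating? (K n) p ×-dec (∣ p ∣ ℕ.≤? k)

-- An insertion leaves a nonempty set, so only the bound `k` can fail.
x∉p⇒isVertex-toggle⇔ : ∀ {k x} {p : Subset (suc n)} → x ∉ p →
                       IsVertex k (toggle x p) ⇔ ∣ p ∣ < k
x∉p⇒isVertex-toggle⇔ {k = k} x∉p = mk⇔
  (λ (_ , ≤k) → subst (_≤ k) (x∉p⇒∣toggle∣ x∉p) ≤k)
  (λ <k → Equivalence.from dominating⇔0<∣p∣ (subst (0 <_) (sym (x∉p⇒∣toggle∣ x∉p)) z<s) ,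
          subst (_≤ k) (sym (x∉p⇒∣toggle∣ x∉p)) <k)

-- A removal respects the bound `k`, so only nonemptiness can fail.
x∈p⇒isVertex-toggle⇔ : ∀ {k x} {p : Subset (suc n)} → x ∈ p → ∣ p ∣ ≤ k →
                       IsVertex k (toggle x p) ⇔ 1 < ∣ p ∣
x∈p⇒isVertex-toggle⇔ {k = k} x∈p ∣p∣≤k = mk⇔
  (λ (dom , _) → subst (1 <_) (x∈p⇒∣toggle∣ x∈p) (s<s (Equivalence.to dominating⇔0<∣p∣ dom)))
  (λ 1< → Equivalence.from dominating⇔0<∣p∣
            (s<s⁻¹ (subst (1 <_) (sym (x∈p⇒∣toggle∣ x∈p)) 1<)) ,
          ℕ.<⇒≤ (subst (_≤ k) (sym (x∈p⇒∣toggle∣ x∈p)) ∣p∣≤k))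

2∣n⊎2∣1+n : ∀ n → (2 ∣ n) ⊎ (2 ∣ suc n)
2∣n⊎2∣1+n zero    = inj₁ (2 ∣0)
2∣n⊎2∣1+n (suc n) = [ inj₂ ∘ ∣m∣n⇒∣m+n ∣-refl , inj₁ ]′ (2∣n⊎2∣1+n n)

2∣n⇒2∤1+n : ∀ {n} → 2 ∣ n → ¬ 2 ∣ suc n
2∣n⇒2∤1+n {n} 2∣n 2∣1+n =
  contradiction (∣1⇒≡1 (∣m+n∣m⇒∣n (subst (2 ∣_) (sym (ℕ.+-comm n 1)) 2∣1+n) 2∣n)) λ ()

-- Neighbours and degrees in `𝒟 k (K n)`.

module _ {n k : ℕ} where

  private
    module 𝒟 = Graph (𝒟 k (K n))

  adj⇒toggle : ∀ {D E} → 𝒟.Adj D E → ∃ λ x → value E ≡ toggle x (value D)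
  adj⇒toggle (inj₁ D→E) = obtainedFrom⇒toggle D→E
  adj⇒toggle {D} {E} (inj₂ E→D) with x , refl ← obtainedFrom⇒toggle E→D =
    x , sym (toggle-involutive x (value E))

  neighbour↔toggle : ∀ D → 𝒟.Neighbour D ↔
                     Refinement (Fin n) (λ x → IsVertex k (toggle x (value D)))
  neighbour↔toggle D@(p ⊣ _) = mk↔ₛ′ to from
    -- `toggled` takes its element from a recomputed proof, so its agreement with `x` comes from
    -- injectivity and not from computation.
    (λ (x ⊣ _) → value-injective (toggle-injectiveˡ p (sym (proj₂ (toggled (from (x ⊣ _)))))))
    (λ E → value-injective (value-injective (sym (proj₂ (toggled E)))))
    where
    toggled : (E : 𝒟.Neighbour D) → ∃ λ x → value (value E) ≡ toggle x p
    -- The adjacency proof is irrelevant; decidability of adjacency recovers one from which an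
    -- element can be extracted.
    toggled (E ⊣ [ D~E ]) = adj⇒toggle {D} {E} (recompute (𝒟.adj? D E) D~E)
    to : 𝒟.Neighbour D → Refinement (Fin n) (λ x → IsVertex k (toggle x p))
    to N@((_ ⊣ [ q ]) ⊣ _) = proj₁ (toggled N) ⊣ [ subst (IsVertex k) (proj₂ (toggled N)) q ]
    from : Refinement (Fin n) (λ x → IsVertex k (toggle x p)) → 𝒟.Neighbour D
    from (x ⊣ v) = (toggle x p ⊣ v) ⊣ [ inj₁ (toggle-obtainedFrom x p) ]

  -- The bijection moves the count from the vertices of `𝒟 k (K n)` to `Fin n`. Computing a degree
  -- then amounts to naming the set `S` of admissible toggles: below, the complement of `D`, the
  -- full set, or `D` itself.
  degree≡∣S∣ : ∀ D S → (∀ x → IsVertex k (toggle x (value D)) ⇔ x ∈ S) → 𝒟.degree D ≡ ∣ S ∣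
  degree≡∣S∣ D S V⇔S = trans
    (finite-card-unique
      (refinement-finite 𝒟.V-finite (𝒟.adj? D))
      (Fin-refinement-finite n (isVertex? k ∘ λ x → toggle x (value D)))
      (neighbour↔toggle D))
    (card-Fin-refinement (isVertex? k ∘ λ x → toggle x (value D)) S V⇔S)

module _ {n k : ℕ} where

  private
    module 𝒟 = Graph (𝒟 k (K (suc n)))

  ∣_∣≤k : (D : 𝒟.V) → ∣ value D ∣ ≤ k
  ∣ p ⊣ [ v ] ∣≤k = proj₂ (recompute (isVertex? k p) v)

  0<∣_∣ : (D : 𝒟.V) → 0 < ∣ value D ∣
  0<∣ p ⊣ [ v ] ∣ = Equivalence.to dominating⇔0<∣p∣ (proj₁ (recompute (isVertex? k p) v))

  -- The one possible removal would empty the set, while each of the `n` insertions gives size 2,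
  -- which `1 < k` permits.
  degree-singleton : ∀ D → ∣ value D ∣ ≡ 1 → 1 < k → 𝒟.degree D ≡ n
  degree-singleton D ∣D∣≡1 1<k = trans
    (degree≡∣S∣ D (∁ (value D)) V⇔∁)
    (trans (∣∁p∣≡n∸∣p∣ (value D)) (cong (suc n ∸_) ∣D∣≡1))
    where
    V⇔∁ : ∀ x → IsVertex k (toggle x (value D)) ⇔ x ∈ ∁ (value D)
    V⇔∁ x with x ∈? value D
    ... | yes x∈D = mk⇔
      (λ v → contradiction ∣D∣≡1 (ℕ.>⇒≢ (Equivalence.to (x∈p⇒isVertex-toggle⇔ x∈D ∣ D ∣≤k) v)))
      (λ x∈∁ → contradiction x∈D (x∈∁p⇒x∉p x∈∁))
    ... | no  x∉D = mk⇔
      (λ _ → x∉p⇒x∈∁p x∉D)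
      (λ _ → Equivalence.from (x∉p⇒isVertex-toggle⇔ x∉D) (subst (_< k) (sym ∣D∣≡1) 1<k))

  -- Strictly between the two size bounds neither removal nor insertion can fail.
  degree-inner : ∀ D → 1 < ∣ value D ∣ → ∣ value D ∣ < k → 𝒟.degree D ≡ suc n
  degree-inner D 1<∣D∣ ∣D∣<k = trans (degree≡∣S∣ D ⊤ V⇔⊤) (∣⊤∣≡n (suc n))
    where
    V⇔⊤ : ∀ x → IsVertex k (toggle x (value D)) ⇔ x ∈ ⊤
    V⇔⊤ x with x ∈? value D
    ... | yes x∈D = mk⇔ (λ _ → ∈⊤) (λ _ → Equivalence.from (x∈p⇒isVertex-toggle⇔ x∈D ∣ D ∣≤k) 1<∣D∣)
    ... | no  x∉D = mk⇔ (λ _ → ∈⊤) (λ _ → Equivalence.from (x∉p⇒isVertex-toggle⇔ x∉D) ∣D∣<k)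

  -- Every insertion would exceed `k`, and every removal leaves a nonempty set.
  degree-maximal : ∀ D → 1 < ∣ value D ∣ → ∣ value D ∣ ≡ k → 𝒟.degree D ≡ k
  degree-maximal D 1<∣D∣ ∣D∣≡k = trans (degree≡∣S∣ D (value D) V⇔D) ∣D∣≡k
    where
    V⇔D : ∀ x → IsVertex k (toggle x (value D)) ⇔ x ∈ value D
    V⇔D x with x ∈? value D
    ... | yes x∈D = mk⇔ (λ _ → x∈D) (λ _ → Equivalence.from (x∈p⇒isVertex-toggle⇔ x∈D ∣ D ∣≤k) 1<∣D∣)
    ... | no  x∉D = mk⇔
      (λ v → contradiction ∣D∣≡k (ℕ.<⇒≢ (Equivalence.to (x∉p⇒isVertex-toggle⇔ x∉D) v)))
      (λ x∈D → contradiction x∈D x∉D)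

  -- Connectivity.

  vertex : (p : Subset (suc n)) → 0 < ∣ p ∣ → ∣ p ∣ ≤ k → 𝒟.V
  vertex p 0<∣p∣ ∣p∣≤k = p ⊣ [ Equivalence.from dominating⇔0<∣p∣ 0<∣p∣ , ∣p∣≤k ]

  module _ (1<k : 1 < k) where

    singleton : Fin (suc n) → 𝒟.V
    singleton a = vertex ⁅ a ⁆ (subst (0 <_) (sym (∣⁅x⁆∣≡1 a)) z<s)
                               (subst (_≤ k) (sym (∣⁅x⁆∣≡1 a)) (ℕ.<⇒≤ 1<k))

    -- Written as a toggle of `⁅ a ⁆`, so that `toggle-obtainedFrom` directly gives its edge to
    -- `singleton a`. It also serves as the set of size 2 in the parity argument.
    pair : {a b : Fin (suc n)} → b ≢ a → 𝒟.V
    pair {a} {b} b≢a = toggle b ⁅ a ⁆ ⊣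
      [ Equivalence.from (x∉p⇒isVertex-toggle⇔ (x≢y⇒x∉⁅y⁆ b≢a)) (subst (_< k) (sym (∣⁅x⁆∣≡1 a)) 1<k) ]

    ∣pair∣≡2 : {a b : Fin (suc n)} (b≢a : b ≢ a) → ∣ value (pair b≢a) ∣ ≡ 2
    ∣pair∣≡2 {a} b≢a = trans (x∉p⇒∣toggle∣ (x≢y⇒x∉⁅y⁆ b≢a)) (cong suc (∣⁅x⁆∣≡1 a))

    -- Induction on the size `s`: elements other than `a` are removed one at a time, and `a` keeps
    -- every intermediate set nonempty.
    connected-singleton : ∀ s D {a} → ∣ value D ∣ ≡ s → a ∈ value D → 𝒟.Connected D (singleton a)
    connected-singleton zero D ∣D∣≡0 a∈D = contradiction ∣D∣≡0 (ℕ.>⇒≢ (x∈p⇒0<∣p∣ a∈D))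
    connected-singleton (suc s) D@(p ⊣ _) {a} ∣D∣≡1+s a∈D
      with Fin.any? (λ x → (x ∈? p) ×-dec ¬? (x Fin.≟ a))
    ... | yes (x , x∈D , x≢a) =
      inj₁ (toggle-obtainedFrom x p) ◅
      connected-singleton s E (ℕ.suc-injective (trans (x∈p⇒∣toggle∣ x∈D) ∣D∣≡1+s)) a∈E
      where
      a∈E : a ∈ toggle x p
      a∈E = updateAt-minimal a x p (x≢a ∘ sym) a∈D
      E : 𝒟.V
      E = vertex (toggle x p) (x∈p⇒0<∣p∣ a∈E)
            (ℕ.<⇒≤ (subst (_≤ k) (sym (x∈p⇒∣toggle∣ x∈D)) ∣ D ∣≤k))
    -- No element other than `a` is left, so `D` already is `singleton a` and the path is empty.
    ... | no ∄x = subst (𝒟.Connected D) (value-injective (⊆-antisym D⊆⁅a⁆ ⁅a⁆⊆D)) ε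
      where
      D⊆⁅a⁆ : p ⊆ ⁅ a ⁆
      D⊆⁅a⁆ {x} x∈D with x Fin.≟ a
      ... | yes refl = x∈⁅x⁆ a
      ... | no  x≢a  = contradiction (x , x∈D , x≢a) ∄x
      ⁅a⁆⊆D : ⁅ a ⁆ ⊆ p
      ⁅a⁆⊆D x∈⁅a⁆ with refl ← x∈⁅y⁆⇒x≡y a x∈⁅a⁆ = a∈D

    -- For distinct elements the path goes up to the pair containing both and then down to
    -- `singleton b`.
    connected-singletons : ∀ a b → 𝒟.Connected (singleton a) (singleton b)
    connected-singletons a b with b Fin.≟ a
    ... | yes refl = ε
    ... | no  b≢a  = inj₁ (toggle-obtainedFrom b ⁅ a ⁆) ◅
      connected-singleton _ (pair b≢a) refl (x∉p⇒x∈toggle (x≢y⇒x∉⁅y⁆ b≢a))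

    connected : ∀ D E → 𝒟.Connected D E
    connected D E with a , a∈D ← 0<∣p∣⇒Nonempty 0<∣ D ∣ | b , b∈E ← 0<∣p∣⇒Nonempty 0<∣ E ∣ =
      connected-singleton _ D refl a∈D ◅◅ connected-singletons a b ◅◅
      reverse (λ {i} {j} → 𝒟.adj-sym {i} {j}) (connected-singleton _ E refl b∈E)

    -- The parity conditions.

    eulerian⇒odd : 𝒟.Eulerian → ¬ 2 ∣ suc n
    -- The graph `K (suc n)` has order `suc n`, but a singleton has degree `n`; evenness of the
    -- latter makes the order odd.
    eulerian⇒odd (even , _) = 2∣n⇒2∤1+n (subst (2 ∣_)
      (degree-singleton (singleton zero) (∣⁅x⁆∣≡1 {suc n} zero) 1<k)
      (even (singleton zero)))

    -- If `2 < k`, a pair has inner size and hence degree `suc n`, which is odd.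
    eulerian⇒k≡2 : 2 ≤ suc n → 𝒟.Eulerian → k ≡ 2
    eulerian⇒k≡2 2≤1+n eul@(even , _) = ℕ.≤-antisym (ℕ.≮⇒≥ 2≮k) 1<k
      where
      -- `2 ≤ suc n` unfolds to `1 < suc n`, so `fromℕ<` yields the element with index 1.
      x≢0 : fromℕ< 2≤1+n ≢ zero
      x≢0 x≡0 = contradiction (trans (sym (Fin.toℕ-fromℕ< 2≤1+n)) (cong toℕ x≡0)) λ ()
      P : 𝒟.V
      P = pair x≢0
      ∣P∣≡2 : ∣ value P ∣ ≡ 2
      ∣P∣≡2 = ∣pair∣≡2 x≢0
      2≮k : ¬ 2 < k
      2≮k 2<k = eulerian⇒odd eul (subst (2 ∣_)
        (degree-inner P (subst (1 <_) (sym ∣P∣≡2) ℕ.≤-refl) (subst (_< k) (sym ∣P∣≡2) 2<k))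
        (even P))

    -- With `k ≡ 2` only sizes 1 and 2 occur, and the degrees are `n` and 2, both even.
    odd∧k≡2⇒eulerian : ¬ 2 ∣ suc n → k ≡ 2 → 𝒟.Eulerian
    odd∧k≡2⇒eulerian 2∤1+n k≡2 = even , λ D E _ _ → connected D E
      where
      even : ∀ D → 2 ∣ 𝒟.degree D
      -- Case analysis by [_,_]′ because `with` would normalise the degree.
      even D = [ even-maximal , even-singleton ]′ (ℕ.m≤n⇒m<n∨m≡n 0<∣ D ∣)
        where
        even-maximal : 1 < ∣ value D ∣ → 2 ∣ 𝒟.degree D
        even-maximal 1<∣D∣ = subst (2 ∣_) (sym (trans (degree-maximal D 1<∣D∣ ∣D∣≡k) k≡2)) ∣-refl
          where
          ∣D∣≡k : ∣ value D ∣ ≡ k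
          -- `1 < ∣ value D ∣` unfolds to `2 ≤ ∣ value D ∣`, which is the missing lower bound once 2
          -- is replaced by `k`.
          ∣D∣≡k = ℕ.≤-antisym ∣ D ∣≤k (subst (_≤ ∣ value D ∣) (sym k≡2) 1<∣D∣)
        even-singleton : 1 ≡ ∣ value D ∣ → 2 ∣ 𝒟.degree D
        even-singleton 1≡∣D∣ = subst (2 ∣_) (sym (degree-singleton D (sym 1≡∣D∣) 1<k))
          ([ id , (λ 2∣1+n → contradiction 2∣1+n 2∤1+n) ]′ (2∣n⊎2∣1+n n))

mainTheorem5 : (n k : ℕ) → n ≥ 2 → 1 < k → k < n →
    Eulerian (𝒟 k (K n)) ⇔ ((¬ (2 ∣ n)) × (k ≡ 2))
mainTheorem5 (suc n) k n≥2 1<k k<n = mk⇔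
  (λ eul → eulerian⇒odd {n} {k} 1<k eul , eulerian⇒k≡2 {n} {k} 1<k n≥2 eul)
  (λ (2∤n , k≡2) → odd∧k≡2⇒eulerian {n} {k} 1<k 2∤n k≡2)
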